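{- For every integer $k\ge 3$, there exist infinitely many pairwise non-isomorphic $k$-graphs that are minimal asymmetric.
   Context: A $k$-graph is a pair $(X,\mathscr{M})$ with $X$ a finite set and $\mathscr{M}\subseteq\binom{X}{k}$. An automorphism is a bijection $\phi:X\to X$ with $\{\phi(M):M\in\mathscr{M}\}=\mathscr{M}$. A $k$-graph is asymmetric if its only automorphism is the identity, and symmetric otherwise. For $X'\subseteq X$, the induced sub-$k$-graph on $X'$ is $(X',\{M\in\mathscr{M}: M\subseteq X'\})$; it is non-trivial if $1<|X'|<|X|$. A $k$-graph is minimal asymmetric if it is asymmetric and every non-trivial induced sub-$k$-graph of it is symmetric. -}

module Defs where

open import Data.Nat using (ℕ; _<_)
open import Data.Bool using (Bool; true; false; T; _∧_)
open import Data.Fin using (Fin; _≟_)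
open import Data.Fin.Subset using (Subset; ∣_∣)
open import Data.List using (allFin)
open import Data.Bool.ListAction using (any)
open import Data.Vec using (tabulate; lookup)
open import Data.Product using (Σ; ∃; _×_; proj₁)
open import Function.Bundles using (_↔_; Inverse)
open import Relation.Nullary using (¬_)
open import Relation.Nullary.Decidable using (⌊_⌋)
open import Relation.Binary.PropositionalEquality using (_≡_; _≢_)

IsKGraph : ℕ → (n : ℕ) → (Subset n → Bool) → Set
IsKGraph k n E = ∀ s → T (E s) → ∣ s ∣ ≡ k

KGraph : ℕ → ℕ → Set
KGraph k n = Σ (Subset n → Bool) (IsKGraph k n)

image : ∀ {m n} → (Fin m → Fin n) → Subset m → Subset n
image {m} f S = tabulate (λ i → any (λ j → lookup S j ∧ ⌊ f j ≟ i ⌋) (allFin m))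

MapsOnto : ∀ {m n} → (Fin m → Fin n) → (Subset m → Bool) → (Subset n → Bool) → Set
MapsOnto f E F =
  (∀ M → T (E M) → T (F (image f M))) ×
  (∀ N → T (F N) → ∃ λ M → T (E M) × image f M ≡ N)

IsAut : ∀ {n} → (Subset n → Bool) → (Fin n ↔ Fin n) → Set
IsAut E φ = MapsOnto (Inverse.to φ) E E

Asymmetric : ∀ {n} → (Subset n → Bool) → Set
Asymmetric E = ∀ φ → IsAut E φ → ∀ i → Inverse.to φ i ≡ i

Symmetric : ∀ {n} → (Subset n → Bool) → Set
Symmetric E = ¬ Asymmetric E

-- Induced sub-k-graph on the subset X' = e(Fin m) ⊆ Fin n, where e is an
-- injection; it is re-indexed onto the vertex set Fin m via e:
-- S ⊆ Fin m is an edge iff e(S) ∈ ℳ (every edge contained in X' is some e(S)).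
induced : ∀ {m n} → (Fin m → Fin n) → (Subset n → Bool) → (Subset m → Bool)
induced e E S = E (image e S)

Injective : ∀ {m n} → (Fin m → Fin n) → Set
Injective f = ∀ i j → f i ≡ f j → i ≡ j

-- minimal asymmetric: asymmetric, and every non-trivial induced sub-k-graph
-- (on X' with 1 < |X'| < |X|) is symmetric.  Subsets X' of size m are exactly
-- the images of injections Fin m → Fin n.
MinimalAsymmetric : ∀ {k n} → KGraph k n → Set
MinimalAsymmetric {k} {n} G =
  Asymmetric (proj₁ G) ×
  (∀ m → 1 < m → m < n → (e : Fin m → Fin n) → Injective e →
     Symmetric (induced e (proj₁ G)))

Isomorphic : ∀ {k n m} → KGraph k n → KGraph k m → Set
Isomorphic {k} {n} {m} G H =
  Σ (Fin n ↔ Fin m) λ f → MapsOnto (Inverse.to f) (proj₁ G) (proj₁ H)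

{-# OPTIONS --safe #-}
module Submission where

-- The case k = 3.  Take vertices p, q, s, w₀, …, wₜ, u₀, …, uₜ₋₁ (t ≥ 1) and edges
--   α = {w₀, p, q},  β = {p, q, wₜ},  γ = {q, wₜ, s},  link j = {wⱼ, uⱼ, wⱼ₊₁}.
-- Only {p, q} and {q, wₜ} lie in two common edges, so an automorphism fixes q;
-- from there all other vertices are forced, the path of links one after the other.
-- Losing an edge creates two vertices lying in the same remaining edges: p and q
-- if γ is lost, w₀ and u₀ if α is lost, and wⱼ₊₁ with uⱼ or uⱼ₊₁ where the path
-- breaks.  If all links are lost, then q and wₜ are exchangeable when α is lost
-- too, while w₀ ↔ s, p ↔ wₜ is a symmetry when α, β, γ all survive.
--
-- From k to k + 1: the family of minimal asymmetric k-graphs is closed under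
-- complementation, and so the cone over the complement, with a new vertex (the
-- apex) added to every k-set that is not an edge, is again minimal asymmetric
-- as long as the apex is the only vertex in every edge.  Without the complement
-- two successive apexes would be interchangeable.

open import Defs
open import Data.Bool as Bool using (Bool; true; false; T; T?; _∧_; not)
open import Data.Bool.Properties using (T-∧; T-≡)
open import Data.Empty using (⊥-elim)
open import Data.Fin using (Fin; zero; suc; _≟_; lift; punchIn; punchOut; _↑ˡ_; _↑ʳ_; fromℕ; inject₁; toℕ; splitAt)
open import Data.Fin.Induction using (<-weakInduction)
open import Data.Fin.Patterns
open import Data.Fin.Permutation using (remove; punchIn-permute; ↔⇒≡)
open import Data.Fin.Permutation.Components using (transpose)
open import Data.Fin.Properties as Fin using (any?; all?; ¬∀⟶∃¬; suc-injective; pigeonhole; punchIn-injective; punchInᵢ≢i; punchIn-punchOut; inject₁-injective; fromℕ≢inject₁; toℕ-inject₁; splitAt-↑ˡ; splitAt-↑ʳ; splitAt⁻¹-↑ˡ; splitAt⁻¹-↑ʳ)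
open import Data.Fin.Relation.Unary.Top using (view; ‵fromℕ; ‵inject₁)
open import Data.Fin.Subset using (Subset; ∣_∣; _∈_; _∉_; _⊆_; _∪_; ⁅_⁆; ⊤; ⊥; inside; outside; Empty)
open import Data.Fin.Subset.Properties using (_∈?_; ∈⊤; ∣⊤∣≡n; ∣⊥∣≡0; Empty-unique; ⊆-antisym; ∪-identityˡ; x∈⁅x⁆; x∈⁅y⁆⇒x≡y; ∣⁅x⁆∣≡1; x∈p∪q⁺; x∈p∪q⁻; p⊆q⇒∣p∣≤∣q∣; p⊂q⇒∣p∣<∣q∣; drop-there; drop-∷-⊆)
open import Data.List using (allFin)
open import Data.List.Membership.Propositional using (lose)
open import Data.List.Membership.Propositional.Properties using (∈-allFin)
open import Data.List.Relation.Unary.Any using (satisfied)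
open import Data.List.Relation.Unary.Any.Properties using (any⁺; any⁻)
open import Data.Nat as ℕ using (ℕ; zero; suc; _+_; _≤_; _<_; z≤n; s≤s; s≤s⁻¹)
open import Data.Nat.Properties using (≤-trans; <-irrefl; <-cmp; <⇒≢; n≤1+n; m≢1+n+m; +-mono-<; +-monoʳ-<; +-cancelˡ-≡)
open import Data.Product using (Σ; ∃; _×_; _,_; proj₁; proj₂)
open import Data.Sum using (_⊎_; inj₁; inj₂)
open import Data.Vec using (_∷_; []; lookup; here; there)
open import Data.Vec.Properties using (≡-dec; lookup⇒[]=; []=⇒lookup; lookup∘tabulate)
open import Function using (_∘_; id; Equivalence; Inverse; mk↔ₛ′; _↔_)
open import Relation.Binary.Definitions using (tri<; tri≈; tri>)
open import Relation.Binary.PropositionalEquality using (_≡_; _≢_; refl; sym; trans; cong; subst; subst₂)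
open import Relation.Nullary using (¬_; yes; no; contradiction; Dec)
open import Relation.Nullary.Decidable using (⌊_⌋; dec-true; dec-false; toWitness; fromWitness; _×-dec_; ¬?; decidable-stable)
open import Relation.Unary using (Decidable)

private
  variable
    k m n o : ℕ

-- Images of subsets under maps between finite sets

∈-image⁺ : (f : Fin m → Fin n) (S : Subset m) {j : Fin m} → j ∈ S → f j ∈ image f S
∈-image⁺ f S {j} j∈S =
  lookup⇒[]= (f j) _ (trans (lookup∘tabulate _ (f j)) (Equivalence.to T-≡ (any⁺ _ (lose (∈-allFin j) hit))))
  where
  hit : T (lookup S j ∧ ⌊ f j ≟ f j ⌋)
  hit = Equivalence.from T-∧ (Equivalence.from T-≡ ([]=⇒lookup j∈S) , fromWitness refl)

∈-image⁻ : (f : Fin m → Fin n) (S : Subset m) {i : Fin n} → i ∈ image f S → ∃ λ j → j ∈ S × f j ≡ i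
∈-image⁻ f S {i} i∈fS
  with satisfied (any⁻ _ (allFin _) (Equivalence.from T-≡ (trans (sym (lookup∘tabulate _ i)) ([]=⇒lookup i∈fS))))
... | j , hit with Equivalence.to T-∧ hit
...   | j∈S , fj≡i = j , lookup⇒[]= j S (Equivalence.to T-≡ j∈S) , toWitness fj≡i

image-mono : (f : Fin m → Fin n) (S S′ : Subset m) → S ⊆ S′ → image f S ⊆ image f S′
image-mono f S S′ S⊆S′ i∈fS with ∈-image⁻ f S i∈fS
... | j , j∈S , refl = ∈-image⁺ f S′ (S⊆S′ j∈S)

image-cong : {f g : Fin m → Fin n} → (∀ i → f i ≡ g i) → (S : Subset m) → image f S ≡ image g S
image-cong {f = f} {g} f≗g S = ⊆-antisym (half f≗g) (half (sym ∘ f≗g))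
  where
  half : {f g : Fin _ → Fin _} → (∀ i → f i ≡ g i) → image f S ⊆ image g S
  half {f} {g} f≗g i∈fS with ∈-image⁻ f S i∈fS
  ... | j , j∈S , refl = subst (_∈ image g S) (sym (f≗g j)) (∈-image⁺ g S j∈S)

image-id : (S : Subset n) → image id S ≡ S
image-id S = ⊆-antisym sub (∈-image⁺ id S)
  where
  sub : image id S ⊆ S
  sub i∈S with ∈-image⁻ id S i∈S
  ... | j , j∈S , refl = j∈S

image-∘ : (g : Fin n → Fin o) (f : Fin m → Fin n) (S : Subset m) → image g (image f S) ≡ image (g ∘ f) S
image-∘ g f S = ⊆-antisym to from
  where
  to : image g (image f S) ⊆ image (g ∘ f) S
  to i∈ with ∈-image⁻ g (image f S) i∈
  ... | _ , j∈fS , refl with ∈-image⁻ f S j∈fS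
  ...   | _ , l∈S , refl = ∈-image⁺ (g ∘ f) S l∈S
  from : image (g ∘ f) S ⊆ image g (image f S)
  from i∈ with ∈-image⁻ (g ∘ f) S i∈
  ... | _ , l∈S , refl = ∈-image⁺ g (image f S) (∈-image⁺ f S l∈S)

image-involutive : {f : Fin n → Fin n} → (∀ i → f (f i) ≡ i) → (S : Subset n) → image f (image f S) ≡ S
image-involutive {f = f} ff S = trans (image-∘ f f S) (trans (image-cong ff S) (image-id S))

∈-image-injective : {f : Fin m → Fin n} → Injective f → (S : Subset m) {j : Fin m} → f j ∈ image f S → j ∈ S
∈-image-injective {f = f} inj S {j} fj∈ with ∈-image⁻ f S fj∈
... | l , l∈S , fl≡fj = subst (_∈ S) (inj l j fl≡fj) l∈S

image-injective : {f : Fin m → Fin n} → Injective f → (S S′ : Subset m) → image f S ≡ image f S′ → S ≡ S′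
image-injective {f = f} inj S S′ eq = ⊆-antisym (half S S′ eq) (half S′ S (sym eq))
  where
  half : ∀ S S′ → image f S ≡ image f S′ → S ⊆ S′
  half S S′ eq i∈S = ∈-image-injective inj S′ (subst (_ ∈_) eq (∈-image⁺ f S i∈S))

∣⁅x⁆∪p∣ : {x : Fin n} {p : Subset n} → x ∉ p → ∣ ⁅ x ⁆ ∪ p ∣ ≡ suc ∣ p ∣
∣⁅x⁆∪p∣ {x = zero}  {outside ∷ p} _   = cong (suc ∘ ∣_∣) (∪-identityˡ p)
∣⁅x⁆∪p∣ {x = zero}  {inside ∷ p}  x∉p = contradiction here x∉p
∣⁅x⁆∪p∣ {x = suc x} {outside ∷ p} x∉p = ∣⁅x⁆∪p∣ (x∉p ∘ there)
∣⁅x⁆∪p∣ {x = suc x} {inside ∷ p}  x∉p = cong suc (∣⁅x⁆∪p∣ (x∉p ∘ there))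

∣image∣ : {f : Fin m → Fin n} → Injective f → (S : Subset m) → ∣ image f S ∣ ≡ ∣ S ∣
∣image∣ {n = n} {f = f} inj [] = trans (cong ∣_∣ (Empty-unique empty)) (∣⊥∣≡0 n)
  where
  empty : Empty (image f [])
  empty (_ , i∈) with ∈-image⁻ f [] i∈
  ... | () , _
∣image∣ {f = f} inj (outside ∷ S) = trans (cong ∣_∣ (⊆-antisym to from)) (∣image∣ (λ i j → suc-injective ∘ inj _ _) S)
  where
  to : image f (outside ∷ S) ⊆ image (f ∘ suc) S
  to i∈ with ∈-image⁻ f (outside ∷ S) i∈
  ... | _ , there j∈S , refl = ∈-image⁺ (f ∘ suc) S j∈S
  from : image (f ∘ suc) S ⊆ image f (outside ∷ S)
  from i∈ with ∈-image⁻ (f ∘ suc) S i∈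
  ... | _ , j∈S , refl = ∈-image⁺ f (outside ∷ S) (there j∈S)
∣image∣ {f = f} inj (inside ∷ S) =
  trans (cong ∣_∣ (⊆-antisym to from))
    (trans (∣⁅x⁆∪p∣ f₀∉) (cong suc (∣image∣ (λ i j → suc-injective ∘ inj _ _) S)))
  where
  f₀∉ : f zero ∉ image (f ∘ suc) S
  f₀∉ i∈ with ∈-image⁻ (f ∘ suc) S i∈
  ... | _ , _ , eq with inj _ _ eq
  ...   | ()
  to : image f (inside ∷ S) ⊆ ⁅ f zero ⁆ ∪ image (f ∘ suc) S
  to i∈ with ∈-image⁻ f (inside ∷ S) i∈
  ... | _ , here      , refl = x∈p∪q⁺ (inj₁ (x∈⁅x⁆ (f zero)))
  ... | _ , there j∈S , refl = x∈p∪q⁺ (inj₂ (∈-image⁺ (f ∘ suc) S j∈S))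
  from : ⁅ f zero ⁆ ∪ image (f ∘ suc) S ⊆ image f (inside ∷ S)
  from i∈ with x∈p∪q⁻ ⁅ f zero ⁆ (image (f ∘ suc) S) i∈
  ... | inj₁ i∈₁ rewrite x∈⁅y⁆⇒x≡y _ i∈₁ = ∈-image⁺ f (inside ∷ S) here
  ... | inj₂ i∈₂ with ∈-image⁻ (f ∘ suc) S i∈₂
  ...   | _ , j∈S , refl = ∈-image⁺ f (inside ∷ S) (there j∈S)

⊆-∣∣-antisym : {p q : Subset n} → p ⊆ q → ∣ p ∣ ≡ ∣ q ∣ → p ≡ q
⊆-∣∣-antisym {p = p} {q} p⊆q eq = ⊆-antisym p⊆q q⊆p
  where
  q⊆p : q ⊆ p
  q⊆p {x} x∈q = decidable-stable (x ∈? p) λ x∉p →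
    <-irrefl eq (p⊂q⇒∣p∣<∣q∣ (p⊆q , x , x∈q , x∉p))

image-lift : (f : Fin m → Fin n) (b : Bool) (S : Subset m) → image (lift 1 f) (b ∷ S) ≡ b ∷ image f S
image-lift f b S = ⊆-antisym to from
  where
  to : image (lift 1 f) (b ∷ S) ⊆ b ∷ image f S
  to i∈ with ∈-image⁻ (lift 1 f) (b ∷ S) i∈
  ... | zero  , here      , refl = here
  ... | suc j , there j∈S , refl = there (∈-image⁺ f S j∈S)
  from : b ∷ image f S ⊆ image (lift 1 f) (b ∷ S)
  from here = ∈-image⁺ (lift 1 f) (b ∷ S) here
  from (there i∈) with ∈-image⁻ f S i∈
  ... | _ , j∈S , refl = ∈-image⁺ (lift 1 f) (b ∷ S) (there j∈S)

↔-injective : (φ : Fin m ↔ Fin n) → Injective (Inverse.to φ)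
↔-injective φ i j eq = trans (sym (strictlyInverseʳ i)) (trans (cong from eq) (strictlyInverseʳ j))
  where open Inverse φ

-- Symmetries of induced subgraphs

-- A non-trivial symmetry of the subgraph induced on X.  Involutions suffice for
-- all the graphs below, and σ may be arbitrary outside X.
record LocalSymmetry (E : Subset n → Bool) (X : Subset n) : Set where
  field
    σ          : Fin n → Fin n
    involutive : ∀ x → σ (σ x) ≡ x
    closed     : ∀ {x} → x ∈ X → σ x ∈ X
    preserves  : ∀ S → S ⊆ X → T (E S) → T (E (image σ S))
    moved      : ∃ λ x → x ∈ X × σ x ≢ x

  σ-injective : Injective σ
  σ-injective x y eq = trans (sym (involutive x)) (trans (cong σ eq) (involutive y))

  image-closed : ∀ S → S ⊆ X → image σ S ⊆ X
  image-closed S S⊆X i∈ with ∈-image⁻ σ S i∈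
  ... | _ , j∈S , refl = closed (S⊆X j∈S)

  -- Since `σ` undoes itself, it also keeps non-edges inside `X`; the cone over the complement
  -- depends on this.
  reflects : ∀ S → S ⊆ X → T (E (image σ S)) → T (E S)
  reflects S S⊆X = subst (T ∘ E) (image-involutive involutive S) ∘ preserves (image σ S) (image-closed S S⊆X)

-- Two distinct members and a missed vertex express 1 < |X| < n without counting. Working with
-- subsets of the ambient vertex set postpones all re-indexing to `induced-symmetric`.
ProperlySymmetric : (Subset n → Bool) → Set
ProperlySymmetric E = ∀ X {x y z} → x ∈ X → y ∈ X → x ≢ y → z ∉ X → LocalSymmetry E X

-- If every vertex were hit, a choice of preimages would inject `Fin n` into the smaller `Fin m`,
-- against the pigeonhole principle.
injective⇒missed : m < n → (e : Fin m → Fin n) → ∃ λ z → ∀ i → e i ≢ z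
injective⇒missed m<n e with ¬∀⟶∃¬ _ (λ z → ∃ λ i → e i ≡ z) (λ z → any? λ i → e i ≟ z) ¬onto
  where
  ¬onto : ¬ (∀ z → ∃ λ i → e i ≡ z)
  ¬onto onto with pigeonhole m<n (proj₁ ∘ onto)
  ... | i , j , i<j , eq = Fin.<⇒≢ i<j (trans (sym (proj₂ (onto i))) (trans (cong e eq) (proj₂ (onto j))))
... | z , ¬hit = z , λ i eq → ¬hit (i , eq)

-- Because `σ` keeps the image of `e`, it pulls back along `e` to an involution `g` on `Fin m`. This
-- is an automorphism of the induced graph, so asymmetry would make `σ` fix the vertex that it
-- moves.
induced-symmetric : {E : Subset n → Bool} {e : Fin m → Fin n} → Injective e →
                    LocalSymmetry E (image e ⊤) → Symmetric (induced e E)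
induced-symmetric {E = E} {e} e-inj L asym with LocalSymmetry.moved L
... | _ , x∈X , σx≢x with ∈-image⁻ e ⊤ x∈X
...   | i , _ , refl = σx≢x (trans (sym (e∘g i)) (cong e (asym (mk↔ₛ′ g g gg gg) (fwd , bwd) i)))
  where
  open LocalSymmetry L
  back : ∀ i → ∃ λ j → j ∈ ⊤ × e j ≡ σ (e i)
  back i = ∈-image⁻ e ⊤ (closed (∈-image⁺ e ⊤ ∈⊤))
  g : Fin _ → Fin _
  g i = proj₁ (back i)
  e∘g : ∀ i → e (g i) ≡ σ (e i)
  e∘g i = proj₂ (proj₂ (back i))
  gg : ∀ i → g (g i) ≡ i
  gg i = e-inj _ _ (trans (e∘g (g i)) (trans (cong σ (e∘g i)) (involutive (e i))))
  fwd : ∀ M → T (E (image e M)) → T (E (image e (image g M)))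
  fwd M = subst (T ∘ E) (trans (image-∘ σ e M) (trans (image-cong (sym ∘ e∘g) M) (sym (image-∘ e g M))))
        ∘ preserves (image e M) (image-mono e M ⊤ (λ _ → ∈⊤))
  bwd : ∀ N → T (E (image e N)) → ∃ λ M → T (E (image e M)) × image g M ≡ N
  bwd N N∈E = image g N , fwd N N∈E , image-involutive gg N

properlySymmetric⇒symmetric : {E : Subset n → Bool} → ProperlySymmetric E →
  ∀ m → 1 < m → m < n → (e : Fin m → Fin n) → Injective e → Symmetric (induced e E)
properlySymmetric⇒symmetric sym-E (suc (suc m)) (s≤s (s≤s z≤n)) m<n e e-inj with injective⇒missed m<n e
... | z , z-missed = induced-symmetric e-inj
  (sym-E (image e ⊤) (∈-image⁺ e ⊤ (∈⊤ {x = zero})) (∈-image⁺ e ⊤ (∈⊤ {x = suc zero}))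
    (λ eq → contradiction (e-inj _ _ eq) λ ())
    (λ z∈ → let j , _ , eq = ∈-image⁻ e ⊤ z∈ in z-missed j eq))

-- Transpositions and twin vertices

transpose-left : (x y : Fin n) → transpose x y x ≡ y
transpose-left x y rewrite dec-true (x ≟ x) refl = refl

transpose-right : (x y : Fin n) → transpose x y y ≡ x
transpose-right x y with y ≟ x
... | yes y≡x = y≡x
... | no _ rewrite dec-true (y ≟ y) refl = refl

transpose-elsewhere : {x y z : Fin n} → z ≢ x → z ≢ y → transpose x y z ≡ z
transpose-elsewhere {x = x} {y} {z} z≢x z≢y
  rewrite dec-false (z ≟ x) z≢x | dec-false (z ≟ y) z≢y = refl

-- An edge inside `X` contains both of `x` and `y` or neither, so their transposition maps it into
-- itself, and onto itself by cardinality.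
twins : {E : Subset n → Bool} {X : Subset n} {x y : Fin n} → x ∈ X → y ∈ X → x ≢ y →
        (∀ S → S ⊆ X → T (E S) → (x ∈ S → y ∈ S) × (y ∈ S → x ∈ S)) → LocalSymmetry E X
twins {E = E} {X} {x} {y} x∈X y∈X x≢y twin = record
  { σ          = τ
  ; involutive = ττ
  ; closed     = τ-closed x∈X y∈X
  ; preserves  = λ S S⊆X S∈E → subst (T ∘ E) (sym (stable S S⊆X S∈E)) S∈E
  ; moved      = x , x∈X , λ eq → x≢y (trans (sym eq) (transpose-left x y))
  }
  where
  τ = transpose x y
  ττ : ∀ z → τ (τ z) ≡ z
  ττ z with z ≟ x
  ... | yes refl = transpose-right x y
  ... | no z≢x with z ≟ y
  ...   | yes refl = transpose-left x y
  ...   | no z≢y = transpose-elsewhere z≢x z≢y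
  τ-closed : ∀ {S} → x ∈ S → y ∈ S → ∀ {z} → z ∈ S → τ z ∈ S
  τ-closed x∈S y∈S {z} z∈S with z ≟ x
  ... | yes refl = y∈S
  ... | no _ with z ≟ y
  ...   | yes refl = x∈S
  ...   | no _ = z∈S
  stable-⊆ : ∀ S → S ⊆ X → T (E S) → image τ S ⊆ S
  stable-⊆ S S⊆X S∈E i∈ with ∈-image⁻ τ S i∈
  ... | z , z∈S , refl with twin S S⊆X S∈E | x ∈? S
  ...   | x→y , _ | yes x∈S = τ-closed x∈S (x→y x∈S) z∈S
  ...   | _ , y→x | no x∉S  = subst (_∈ S) (sym (transpose-elsewhere (λ { refl → x∉S z∈S }) (λ { refl → x∉S (y→x z∈S) }))) z∈S
  stable : ∀ S → S ⊆ X → T (E S) → image τ S ≡ S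
  stable S S⊆X S∈E = ⊆-∣∣-antisym (stable-⊆ S S⊆X S∈E)
    (∣image∣ (λ i j eq → trans (sym (ττ i)) (trans (cong τ eq) (ττ j))) S)

edgeless : {E : Subset n → Bool} {X : Subset n} {x y : Fin n} → x ∈ X → y ∈ X → x ≢ y →
           (∀ S → S ⊆ X → ¬ T (E S)) → LocalSymmetry E X
edgeless x∈X y∈X x≢y none = twins x∈X y∈X x≢y λ S S⊆X S∈E → contradiction S∈E (none S S⊆X)

-- The cone over the complement

record Extendable (k n : ℕ) : Set where
  field
    E                 : Subset n → Bool
    uniform           : IsKGraph k n E
    asymmetric        : Asymmetric E
    properlySymmetric : ProperlySymmetric E
    -- Makes the apex of the cone below the only vertex lying in every edge.
    avoiding          : ∀ x → ∃ λ S → x ∉ S × ∣ S ∣ ≡ k × ¬ T (E S)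
    -- Leaves room for sets of size `suc k` that miss any given vertex; in `extend` these serve as
    -- non-edges without the apex.
    large             : 2 + k ≤ n

  graph : KGraph k n
  graph = E , uniform

  minimalAsymmetric : MinimalAsymmetric graph
  minimalAsymmetric = asymmetric , properlySymmetric⇒symmetric properlySymmetric

subsetOfSize : k ≤ n → ∃ λ (S : Subset n) → ∣ S ∣ ≡ k
subsetOfSize {n = n} z≤n = ⊥ , ∣⊥∣≡0 n
subsetOfSize (s≤s k≤n) with subsetOfSize k≤n
... | S , eq = inside ∷ S , cong suc eq

-- The size test cuts the complement down to sets of size `k`, since a uniform `E` is false on all
-- other sizes.
cone : ℕ → (Subset n → Bool) → Subset (suc n) → Bool
cone k E (outside ∷ S) = false
cone k E (inside ∷ S)  = ⌊ ∣ S ∣ ℕ.≟ k ⌋ ∧ not (E S)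

another-or-singleton : {X : Subset n} {y : Fin n} → y ∈ X → (∃ λ x → x ∈ X × x ≢ y) ⊎ X ⊆ ⁅ y ⁆
another-or-singleton {X = X} {y} y∈X with any? (λ x → (x ∈? X) ×-dec ¬? (x ≟ y))
... | yes other = inj₁ other
... | no none   = inj₂ λ {x} x∈X →
  subst (_∈ ⁅ y ⁆) (sym (decidable-stable (x ≟ y) λ x≢y → none (x , x∈X , x≢y))) (x∈⁅x⁆ y)

T-not⁺ : ∀ {b} → ¬ T b → T (not b)
T-not⁺ {false} _ = _
T-not⁺ {true}  f = f _

T-not⁻ : ∀ {b} → T (not b) → ¬ T b
T-not⁻ {false} _ ()

module _ {E : Subset n → Bool} where

  cone⁺ : (S : Subset n) → ∣ S ∣ ≡ k → ¬ T (E S) → T (cone k E (inside ∷ S))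
  cone⁺ S size S∉E = Equivalence.from T-∧ (fromWitness size , T-not⁺ S∉E)

  cone⁻ : (S : Subset n) → T (cone k E (inside ∷ S)) → ∣ S ∣ ≡ k × ¬ T (E S)
  cone⁻ S S∈ with Equivalence.to T-∧ S∈
  ... | size , S∉E = toWitness size , T-not⁻ S∉E

  apex∈ : (S : Subset (suc n)) → T (cone k E S) → zero ∈ S
  apex∈ (inside ∷ S) _ = here

  cone-uniform : IsKGraph (suc k) (suc n) (cone k E)
  cone-uniform (inside ∷ S) S∈ = cong suc (proj₁ (cone⁻ S S∈))

  -- The apex lies in every edge, and by `avoid` no other vertex does, so an automorphism fixes the
  -- apex. What it does on the remaining vertices preserves the complement of `E`, hence `E` itself.
  cone-asymmetric : IsKGraph k n E → Asymmetric E → (∀ x → ∃ λ S → x ∉ S × ∣ S ∣ ≡ k × ¬ T (E S)) →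
                    Asymmetric (cone k E)
  cone-asymmetric {k = k} unif asym avoid φ (fwd , bwd) = fixed
    where
    f = Inverse.to φ

    f₀≢1+ : ∀ y → f zero ≢ suc y
    f₀≢1+ y eq with avoid y
    ... | S , y∉S , size , S∉E with bwd (inside ∷ S) (cone⁺ S size S∉E)
    ...   | M , M∈ , fM≡S = y∉S (drop-there (subst₂ _∈_ eq fM≡S (∈-image⁺ f M (apex∈ M M∈))))

    f₀≡0 : f zero ≡ zero
    f₀≡0 = decidable-stable (f zero ≟ zero) λ f₀≢0 →
      f₀≢1+ (punchOut (f₀≢0 ∘ sym)) (sym (punchIn-punchOut (f₀≢0 ∘ sym)))

    ψ = remove zero φ
    g = Inverse.to ψ
    h = Inverse.from ψ

    f≗lift : ∀ i → f i ≡ lift 1 g i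
    f≗lift zero    = f₀≡0
    f≗lift (suc i) = trans (punchIn-permute φ zero i) (cong (λ z → punchIn z (g i)) f₀≡0)

    image-f : ∀ b S → image f (b ∷ S) ≡ b ∷ image g S
    image-f b S = trans (image-cong f≗lift (b ∷ S)) (image-lift g b S)

    g∘h : ∀ S → image g (image h S) ≡ S
    g∘h S = trans (image-∘ g h S) (trans (image-cong (Inverse.strictlyInverseˡ ψ) S) (image-id S))

    ∣g∣ : ∀ S → ∣ image g S ∣ ≡ ∣ S ∣
    ∣g∣ = ∣image∣ (↔-injective ψ)

    ψ-fwd : ∀ M → T (E M) → T (E (image g M))
    -- If `image g M` were a non-edge of `E`, adding the apex would make it an edge of the cone. Its
    -- preimage under `φ`, which is `M` with the apex, would be an edge too, so `M` would be a
    -- non-edge of `E`.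
    ψ-fwd M M∈E = decidable-stable (T? _) λ gM∉E →
      let N , N∈ , fN≡gM = bwd (inside ∷ image g M) (cone⁺ (image g M) (trans (∣g∣ M) (unif M M∈E)) gM∉E)
          N≡M = image-injective (↔-injective φ) N (inside ∷ M) (trans fN≡gM (sym (image-f inside M)))
      in proj₂ (cone⁻ M (subst (T ∘ cone k E) N≡M N∈)) M∈E

    ψ-bwd : ∀ N → T (E N) → ∃ λ M → T (E M) × image g M ≡ N
    ψ-bwd N N∈E = M , M∈E , g∘h N
      where
      M = image h N
      M∈E : T (E M)
      M∈E = decidable-stable (T? _) λ M∉E →
        let size = trans (sym (∣g∣ M)) (trans (cong ∣_∣ (g∘h N)) (unif N N∈E))
            fM∈ = subst (T ∘ cone k E) (trans (image-f inside M) (cong (inside ∷_) (g∘h N))) (fwd _ (cone⁺ M size M∉E))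
        in proj₂ (cone⁻ N fM∈) N∈E

    fixed : ∀ i → f i ≡ i
    fixed zero    = f₀≡0
    fixed (suc i) = trans (f≗lift (suc i)) (cong suc (asym ψ (ψ-fwd , ψ-bwd) i))

  -- The lift fixes the apex, and edges of the cone come from non-edges of `E`, so `preserves` for
  -- the lift rests on `reflects` for `σ`.
  lift-symmetry : {X : Subset n} → LocalSymmetry E X → LocalSymmetry (cone k E) (inside ∷ X)
  lift-symmetry {k = k} {X} L = record
    { σ          = lift 1 σ
    ; involutive = λ { zero → refl ; (suc x) → cong suc (involutive x) }
    ; closed     = λ { here → here ; (there x∈X) → there (closed x∈X) }
    ; preserves  = pres
    ; moved      = let x , x∈X , σx≢x = moved in suc x , there x∈X , σx≢x ∘ suc-injective
    }
    where
    open LocalSymmetry L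
    pres : ∀ S → S ⊆ inside ∷ X → T (cone k E S) → T (cone k E (image (lift 1 σ) S))
    pres (inside ∷ S) S⊆X S∈ with cone⁻ S S∈
    ... | size , S∉E = subst (T ∘ cone k E) (sym (image-lift σ inside S))
      (cone⁺ (image σ S) (trans (∣image∣ σ-injective S) size) (S∉E ∘ reflects S (drop-∷-⊆ S⊆X)))

  -- Without the apex no edge survives. With it, the missed vertex is an old one: if two old
  -- vertices are present, a symmetry of the old subgraph lifts, and a single old vertex is too few
  -- for an edge because `k` is at least 2.
  cone-properlySymmetric : 2 ≤ k → ProperlySymmetric E → ProperlySymmetric (cone k E)
  cone-properlySymmetric 2≤k sym-E (outside ∷ X) x∈X y∈X x≢y _ =
    edgeless x∈X y∈X x≢y λ S S⊆X S∈ → contradiction (S⊆X (apex∈ S S∈)) λ ()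
  cone-properlySymmetric {k = k} 2≤k sym-E (inside ∷ X) = go
    where
    through : ∀ {y} → y ∈ X → ∀ {z} → z ∉ X → LocalSymmetry (cone k E) (inside ∷ X)
    through {y} y∈X z∉X with another-or-singleton y∈X
    ... | inj₁ (x , x∈X , x≢y) = lift-symmetry (sym-E X x∈X y∈X x≢y z∉X)
    ... | inj₂ X⊆y = edgeless here (there y∈X) (λ ()) none
      where
      none : ∀ S → S ⊆ inside ∷ X → ¬ T (cone k E S)
      none (inside ∷ S) S⊆X S∈ = <-irrefl refl (≤-trans 2≤k (subst₂ _≤_ (proj₁ (cone⁻ S S∈)) (∣⁅x⁆∣≡1 y)
        (p⊆q⇒∣p∣≤∣q∣ (X⊆y ∘ drop-∷-⊆ S⊆X))))
    go : ∀ {x y z} → x ∈ inside ∷ X → y ∈ inside ∷ X → x ≢ y → z ∉ inside ∷ X → LocalSymmetry (cone k E) (inside ∷ X)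
    go {z = zero}  _ _ _ z∉X = contradiction here z∉X
    go {z = suc z} here here x≢y _ = contradiction refl x≢y
    go {z = suc z} (there x∈X) _ _ z∉X = through x∈X (z∉X ∘ there)
    go {z = suc z} here (there y∈X) _ z∉X = through y∈X (z∉X ∘ there)

extend : 2 ≤ k → Extendable k n → Extendable (suc k) (suc n)
extend {k} {suc n} 2≤k G = record
  { E                 = cone k E
  ; uniform           = cone-uniform
  ; asymmetric        = cone-asymmetric uniform asymmetric avoiding
  ; properlySymmetric = cone-properlySymmetric 2≤k properlySymmetric
  ; avoiding          = avoid
  ; large             = s≤s large
  }
  where
  open Extendable G
  avoid : ∀ x → ∃ λ S → x ∉ S × ∣ S ∣ ≡ suc k × ¬ T (cone k E S)
  avoid zero with subsetOfSize (≤-trans (n≤1+n _) large)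
  ... | S , size = outside ∷ S , (λ ()) , size , λ ()
  avoid (suc y) with subsetOfSize (s≤s⁻¹ large)
  ... | S , size = outside ∷ image (punchIn y) S
                 , (λ { (there y∈) → let j , _ , eq = ∈-image⁻ (punchIn y) S y∈ in punchInᵢ≢i y j eq })
                 , trans (∣image∣ (punchIn-injective y) S) size
                 , λ ()

-- Jumps along a finite sequence, and triples

inject₁≢suc : ∀ {n} (i : Fin n) → inject₁ i ≢ suc i
inject₁≢suc zero    ()
inject₁≢suc (suc i) = inject₁≢suc i ∘ suc-injective

-- Applied to the presence of links: if some but not all of them survive, the path breaks between
-- two consecutive ones.
uniform-or-jump : ∀ {n} {P : Fin (suc n) → Set} → Decidable P → ∃ P →
  (∀ i → P i) ⊎ (∃ λ i → (P (inject₁ i) × ¬ P (suc i)) ⊎ (¬ P (inject₁ i) × P (suc i)))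
uniform-or-jump {zero}  P? (zero , P₀) = inj₁ λ { zero → P₀ }
uniform-or-jump {suc n} {P} P? ∃P with any? (P? ∘ suc)
uniform-or-jump {suc n} {P} P? (zero , P₀)  | no none = inj₂ (zero , inj₁ (P₀ , none ∘ (zero ,_)))
uniform-or-jump {suc n} {P} P? (suc i , Pᵢ) | no none = contradiction (i , Pᵢ) none
uniform-or-jump {suc n} {P} P? ∃P | yes some with uniform-or-jump (P? ∘ suc) some
... | inj₂ (i , jump) = inj₂ (suc i , jump)
... | inj₁ all with P? zero
...   | yes P₀ = inj₁ λ { zero → P₀ ; (suc i) → all i }
...   | no ¬P₀ = inj₂ (zero , inj₂ (¬P₀ , all zero))

triple : {A : Set} → A → A → A → Fin 3 → A
triple x y z 0F = x
triple x y z 1F = y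
triple x y z 2F = z

triple-injective : {A : Set} {x y z : A} → x ≢ y → x ≢ z → y ≢ z →
                   ∀ c d → triple x y z c ≡ triple x y z d → c ≡ d
triple-injective _   _   _   0F 0F _  = refl
triple-injective x≢y _   _   0F 1F eq = contradiction eq x≢y
triple-injective _   x≢z _   0F 2F eq = contradiction eq x≢z
triple-injective x≢y _   _   1F 0F eq = contradiction (sym eq) x≢y
triple-injective _   _   _   1F 1F _  = refl
triple-injective _   _   y≢z 1F 2F eq = contradiction eq y≢z
triple-injective _   x≢z _   2F 0F eq = contradiction (sym eq) x≢z
triple-injective _   _   y≢z 2F 1F eq = contradiction (sym eq) y≢z
triple-injective _   _   _   2F 2F _  = refl

-- The base family of 3-graphs

-- The graph with t = 1 + m links.
module Base (m : ℕ) where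

  -- Named vertices and edges make the combinatorics a matter of pattern matching; `code` and
  -- `support` carry the results over to `Fin order` and its subsets.
  data Vertex : Set where
    p q s : Vertex
    w     : Fin (2 + m) → Vertex
    u     : Fin (1 + m) → Vertex

  last : Fin (2 + m)
  last = fromℕ (1 + m)

  data Edge : Set where
    α β γ : Edge
    link  : Fin (1 + m) → Edge

  corner : Edge → Fin 3 → Vertex
  corner α        = triple (w zero) p q
  corner β        = triple p q (w last)
  corner γ        = triple q (w last) s
  corner (link j) = triple (w (inject₁ j)) (u j) (w (suc j))

  -- Index equations are arguments of the constructors, so that matching does not get stuck on terms
  -- such as `inject₁ j` or `last`.
  data _∈ₑ_ : Vertex → Edge → Set where
    pα : p ∈ₑ α
    pβ : p ∈ₑ β
    qα : q ∈ₑ α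
    qβ : q ∈ₑ β
    qγ : q ∈ₑ γ
    sγ : s ∈ₑ γ
    wα : w zero ∈ₑ α
    wβ : ∀ {i} → i ≡ last → w i ∈ₑ β
    wγ : ∀ {i} → i ≡ last → w i ∈ₑ γ
    wˡ : ∀ {i j} → i ≡ inject₁ j → w i ∈ₑ link j
    wʳ : ∀ {i j} → i ≡ suc j → w i ∈ₑ link j
    uˡ : ∀ {j} → u j ∈ₑ link j

  corner-∈ : ∀ k c → corner k c ∈ₑ k
  corner-∈ α 0F = wα
  corner-∈ α 1F = pα
  corner-∈ α 2F = qα
  corner-∈ β 0F = pβ
  corner-∈ β 1F = qβ
  corner-∈ β 2F = wβ refl
  corner-∈ γ 0F = qγ
  corner-∈ γ 1F = wγ refl
  corner-∈ γ 2F = sγ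
  corner-∈ (link j) 0F = wˡ refl
  corner-∈ (link j) 1F = uˡ
  corner-∈ (link j) 2F = wʳ refl

  ∈-corner : ∀ {x k} → x ∈ₑ k → ∃ λ c → corner k c ≡ x
  ∈-corner pα = 1F , refl
  ∈-corner pβ = 0F , refl
  ∈-corner qα = 2F , refl
  ∈-corner qβ = 1F , refl
  ∈-corner qγ = 0F , refl
  ∈-corner sγ = 2F , refl
  ∈-corner wα = 0F , refl
  ∈-corner (wβ refl) = 2F , refl
  ∈-corner (wγ refl) = 1F , refl
  ∈-corner (wˡ refl) = 0F , refl
  ∈-corner (wʳ refl) = 2F , refl
  ∈-corner uˡ = 1F , refl

  w-injective : ∀ {i j} → w i ≡ w j → i ≡ j
  w-injective refl = refl

  corner-injective : ∀ k c d → corner k c ≡ corner k d → c ≡ d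
  corner-injective α        = triple-injective (λ ()) (λ ()) (λ ())
  corner-injective β        = triple-injective (λ ()) (λ ()) (λ ())
  corner-injective γ        = triple-injective (λ ()) (λ ()) (λ ())
  corner-injective (link j) = triple-injective (λ ()) (inject₁≢suc j ∘ w-injective) (λ ())

  order : ℕ
  order = 3 + ((2 + m) + (1 + m))

  code : Vertex → Fin order
  code p     = 0F
  code q     = 1F
  code s     = 2F
  code (w i) = 3 ↑ʳ (i ↑ˡ (1 + m))
  code (u j) = 3 ↑ʳ ((2 + m) ↑ʳ j)

  side : Fin (2 + m) ⊎ Fin (1 + m) → Vertex
  side (inj₁ i) = w i
  side (inj₂ j) = u j

  decode : Fin order → Vertex
  decode 0F = p
  decode 1F = q
  decode 2F = s
  decode (suc (suc (suc i))) = side (splitAt (2 + m) i)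

  decode-code : ∀ x → decode (code x) ≡ x
  decode-code p = refl
  decode-code q = refl
  decode-code s = refl
  decode-code (w i) = cong side (splitAt-↑ˡ (2 + m) i (1 + m))
  decode-code (u j) = cong side (splitAt-↑ʳ (2 + m) (1 + m) j)

  code-decode : ∀ i → code (decode i) ≡ i
  code-decode 0F = refl
  code-decode 1F = refl
  code-decode 2F = refl
  code-decode (suc (suc (suc i))) with splitAt (2 + m) i in eq
  ... | inj₁ j = cong (3 ↑ʳ_) (splitAt⁻¹-↑ˡ eq)
  ... | inj₂ j = cong (3 ↑ʳ_) (splitAt⁻¹-↑ʳ eq)

  code-injective : ∀ {x y} → code x ≡ code y → x ≡ y
  code-injective {x} {y} eq = trans (sym (decode-code x)) (trans (cong decode eq) (decode-code y))

  code∘corner-injective : ∀ k → Injective (code ∘ corner k)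
  code∘corner-injective k c d = corner-injective k c d ∘ code-injective

  support : Edge → Subset order
  support k = image (code ∘ corner k) ⊤

  ∈-support⁺ : ∀ {x k} → x ∈ₑ k → code x ∈ support k
  ∈-support⁺ {k = k} x∈k with ∈-corner x∈k
  ... | c , refl = ∈-image⁺ (code ∘ corner k) ⊤ {c} ∈⊤

  ∈-support⁻ : ∀ k {i} → i ∈ support k → ∃ λ x → x ∈ₑ k × code x ≡ i
  ∈-support⁻ k i∈ with ∈-image⁻ (code ∘ corner k) ⊤ i∈
  ... | c , _ , refl = corner k c , corner-∈ k c , refl

  code∈support⁻ : ∀ k {x} → code x ∈ support k → x ∈ₑ k
  code∈support⁻ k {x} x∈ with ∈-support⁻ k x∈
  ... | y , y∈k , eq = subst (_∈ₑ k) (code-injective eq) y∈k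

  ∣support∣ : ∀ k → ∣ support k ∣ ≡ 3
  ∣support∣ k = trans (∣image∣ (code∘corner-injective k) ⊤) (∣⊤∣≡n 3)

  edge? : (S : Subset order) → Dec (∃ λ k → support k ≡ S)
  edge? S with ≡-dec Bool._≟_ (support α) S
  ... | yes eq = yes (α , eq)
  ... | no ¬α with ≡-dec Bool._≟_ (support β) S
  ... | yes eq = yes (β , eq)
  ... | no ¬β with ≡-dec Bool._≟_ (support γ) S
  ... | yes eq = yes (γ , eq)
  ... | no ¬γ with any? (λ j → ≡-dec Bool._≟_ (support (link j)) S)
  ... | yes (j , eq) = yes (link j , eq)
  ... | no ¬link = no λ where
    (α , eq)      → ¬α eq
    (β , eq)      → ¬β eq
    (γ , eq)      → ¬γ eq
    (link j , eq) → ¬link (j , eq)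

  E : Subset order → Bool
  E S = ⌊ edge? S ⌋

  support∈E : ∀ k → T (E (support k))
  support∈E k = fromWitness (k , refl)

  E⇒support : ∀ S → T (E S) → ∃ λ k → support k ≡ S
  E⇒support S = toWitness

  uniform : IsKGraph 3 order E
  uniform S S∈E with E⇒support S S∈E
  ... | k , refl = ∣support∣ k

  -- Intersections of edges

  -- The pairs of distinct vertices that lie in two common edges.
  data Linked : Vertex → Vertex → Set where
    pq : Linked p q
    qp : Linked q p
    qw : Linked q (w last)
    wq : Linked (w last) q

  ∈α∩β : ∀ {x} → x ∈ₑ α → x ∈ₑ β → x ≡ p ⊎ x ≡ q
  ∈α∩β pα pβ = inj₁ refl
  ∈α∩β qα qβ = inj₂ refl
  -- There is at least one link, so `w zero` differs from `w last`.
  ∈α∩β wα (wβ ())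

  ∈α∩γ : ∀ {x} → x ∈ₑ α → x ∈ₑ γ → x ≡ q
  ∈α∩γ qα qγ = refl
  ∈α∩γ wα (wγ ())

  ∈β∩γ : ∀ {x} → x ∈ₑ β → x ∈ₑ γ → x ≡ q ⊎ x ≡ w last
  ∈β∩γ qβ qγ = inj₁ refl
  ∈β∩γ (wβ refl) (wγ _) = inj₂ refl

  ∈α∩link : ∀ {x j} → x ∈ₑ α → x ∈ₑ link j → x ≡ w zero
  ∈α∩link wα _ = refl

  ∈β∩link : ∀ {x j} → x ∈ₑ β → x ∈ₑ link j → x ≡ w last
  ∈β∩link (wβ refl) _ = refl

  ∈γ∩link : ∀ {x j} → x ∈ₑ γ → x ∈ₑ link j → x ≡ w last
  ∈γ∩link (wγ refl) _ = refl

  ∈link∩link : ∀ {x i j} → x ∈ₑ link i → x ∈ₑ link j →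
               i ≡ j ⊎ (x ≡ w (inject₁ i) × inject₁ i ≡ suc j) ⊎ (x ≡ w (suc i) × suc i ≡ inject₁ j)
  ∈link∩link uˡ uˡ = inj₁ refl
  ∈link∩link (wˡ refl) (wˡ eq) = inj₁ (inject₁-injective eq)
  ∈link∩link (wˡ refl) (wʳ eq) = inj₂ (inj₁ (refl , eq))
  ∈link∩link (wʳ refl) (wˡ eq) = inj₂ (inj₂ (refl , eq))
  ∈link∩link (wʳ refl) (wʳ eq) = inj₁ (suc-injective eq)

  -- Two links cannot each follow the other, or `toℕ i` would equal `2 + toℕ i`. Hence different
  -- links share at most one vertex.
  step-asymmetric : ∀ {i j : Fin (1 + m)} → inject₁ i ≡ suc j → suc i ≢ inject₁ j
  step-asymmetric {i} {j} eq₁ eq₂ = m≢1+n+m (toℕ i) {1} (trans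
    (trans (sym (toℕ-inject₁ i)) (cong toℕ eq₁)) (cong suc (trans (sym (toℕ-inject₁ j)) (sym (cong toℕ eq₂)))))

  -- Only `α` with `β` and `β` with `γ` meet in two vertices; any other two different edges share at
  -- most one.
  linked : ∀ {x y} k l → k ≢ l → x ∈ₑ k → x ∈ₑ l → y ∈ₑ k → y ∈ₑ l → x ≢ y → Linked x y
  linked α α k≢l _ _ _ _ _ = contradiction refl k≢l
  linked β β k≢l _ _ _ _ _ = contradiction refl k≢l
  linked γ γ k≢l _ _ _ _ _ = contradiction refl k≢l
  linked α β _ xk xl yk yl x≢y with ∈α∩β xk xl | ∈α∩β yk yl
  ... | inj₁ refl | inj₁ refl = contradiction refl x≢y
  ... | inj₁ refl | inj₂ refl = pq
  ... | inj₂ refl | inj₁ refl = qp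
  ... | inj₂ refl | inj₂ refl = contradiction refl x≢y
  linked α γ _ xk xl yk yl x≢y = contradiction (trans (∈α∩γ xk xl) (sym (∈α∩γ yk yl))) x≢y
  linked β γ _ xk xl yk yl x≢y with ∈β∩γ xk xl | ∈β∩γ yk yl
  ... | inj₁ refl | inj₁ refl = contradiction refl x≢y
  ... | inj₁ refl | inj₂ refl = qw
  ... | inj₂ refl | inj₁ refl = wq
  ... | inj₂ refl | inj₂ refl = contradiction refl x≢y
  linked α (link j) _ xk xl yk yl x≢y = contradiction (trans (∈α∩link xk xl) (sym (∈α∩link yk yl))) x≢y
  linked β (link j) _ xk xl yk yl x≢y = contradiction (trans (∈β∩link xk xl) (sym (∈β∩link yk yl))) x≢y
  linked γ (link j) _ xk xl yk yl x≢y = contradiction (trans (∈γ∩link xk xl) (sym (∈γ∩link yk yl))) x≢y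
  linked (link i) (link j) k≢l xk xl yk yl x≢y with ∈link∩link xk xl | ∈link∩link yk yl
  ... | inj₁ refl | _ = contradiction refl k≢l
  ... | inj₂ _    | inj₁ refl = contradiction refl k≢l
  ... | inj₂ (inj₁ (refl , _))  | inj₂ (inj₁ (refl , _))   = contradiction refl x≢y
  ... | inj₂ (inj₁ (_ , eq))    | inj₂ (inj₂ (_ , eq′))    = contradiction eq′ (step-asymmetric eq)
  ... | inj₂ (inj₂ (_ , eq′))   | inj₂ (inj₁ (_ , eq))     = contradiction eq′ (step-asymmetric eq)
  ... | inj₂ (inj₂ (refl , _))  | inj₂ (inj₂ (refl , _))   = contradiction refl x≢y
  linked β α k≢l xk xl yk yl = linked α β (k≢l ∘ sym) xl xk yl yk
  linked γ α k≢l xk xl yk yl = linked α γ (k≢l ∘ sym) xl xk yl yk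
  linked γ β k≢l xk xl yk yl = linked β γ (k≢l ∘ sym) xl xk yl yk
  linked (link j) α k≢l xk xl yk yl = linked α (link j) (k≢l ∘ sym) xl xk yl yk
  linked (link j) β k≢l xk xl yk yl = linked β (link j) (k≢l ∘ sym) xl xk yl yk
  linked (link j) γ k≢l xk xl yk yl = linked γ (link j) (k≢l ∘ sym) xl xk yl yk

  -- Linked pairs form the path `p`, `q`, `w last`, whose only symmetry besides the identity is its
  -- reversal.
  linked-chain : ∀ {x y z} → Linked x y → Linked y z → x ≢ z →
                 y ≡ q × ((x ≡ p × z ≡ w last) ⊎ (x ≡ w last × z ≡ p))
  linked-chain pq qp x≢z = contradiction refl x≢z
  linked-chain pq qw x≢z = refl , inj₁ (refl , refl)
  linked-chain qp pq x≢z = contradiction refl x≢z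
  linked-chain qw wq x≢z = contradiction refl x≢z
  linked-chain wq qp x≢z = refl , inj₂ (refl , refl)
  linked-chain wq qw x≢z = contradiction refl x≢z

  p∈ₑ : ∀ {k} → p ∈ₑ k → k ≡ α ⊎ k ≡ β
  p∈ₑ pα = inj₁ refl
  p∈ₑ pβ = inj₂ refl

  p∈⇒q∈ : ∀ {k} → p ∈ₑ k → q ∈ₑ k
  p∈⇒q∈ pα = qα
  p∈⇒q∈ pβ = qβ

  -- Rigidity of the base graphs

  -- The action `π` on edges is separate data, because the argument settles vertices and edges
  -- alternately along the path.
  record Automorphism : Set where
    field
      ψ   : Vertex → Vertex
      π   : Edge → Edge
      inj : ∀ {x y} → ψ x ≡ ψ y → x ≡ y
      fwd : ∀ {x k} → x ∈ₑ k → ψ x ∈ₑ π k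
      bwd : ∀ {x k} → ψ x ∈ₑ π k → x ∈ₑ k

  module Rigid (A : Automorphism) where
    open Automorphism A

    Fixed : Vertex → Set
    Fixed x = ψ x ≡ x

    fwdᶠ : ∀ {x k} → Fixed x → x ∈ₑ k → x ∈ₑ π k
    fwdᶠ fx x∈k = subst (_∈ₑ _) fx (fwd x∈k)

    bwdᶠ : ∀ {x k} → Fixed x → x ∈ₑ π k → x ∈ₑ k
    bwdᶠ fx x∈πk = bwd (subst (_∈ₑ _) (sym fx) x∈πk)

    separates : ∀ {x k l} → x ∈ₑ k → ¬ x ∈ₑ l → π k ≢ π l
    separates x∈k x∉l eq = x∉l (bwd (subst (_ ∈ₑ_) eq (fwd x∈k)))

    unmoved : ∀ {x y} → Fixed y → x ≢ y → ψ x ≢ y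
    unmoved fy x≢y eq = x≢y (inj (trans eq (sym fy)))

    -- Two different common edges of a pair go to two different edges, so `ψ p`, `ψ q`, `ψ (w last)`
    -- is again a chain of linked pairs.
    q∧ends : Fixed q × ((Fixed p × Fixed (w last)) ⊎ (ψ p ≡ w last × ψ (w last) ≡ p))
    q∧ends = linked-chain
      (linked (π α) (π β) (separates wα λ { (wβ ()) }) (fwd pα) (fwd pβ) (fwd qα) (fwd qβ) ((λ ()) ∘ inj))
      (linked (π β) (π γ) (separates pβ λ ()) (fwd qβ) (fwd qγ) (fwd (wβ refl)) (fwd (wγ refl)) ((λ ()) ∘ inj))
      ((λ ()) ∘ inj)

    fix-q : Fixed q
    fix-q = proj₁ q∧ends

    ends : Fixed p × Fixed (w last)
    ends with proj₂ q∧ends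
    ... | inj₁ fixed = fixed
    ... | inj₂ (_ , ψw≡p)
      -- The last link contains `w last` but not the fixed `q`, whereas every edge through `p`
      -- contains `q`; so `w last` cannot go to `p`.
      with bwdᶠ fix-q (p∈⇒q∈ (subst (_∈ₑ _) ψw≡p (fwd (wʳ {j = fromℕ m} refl))))
    ...   | ()

    fix-p : Fixed p
    fix-p = proj₁ ends

    fix-last : Fixed (w last)
    fix-last = proj₂ ends

    π-α : π α ≡ α
    π-α with p∈ₑ (fwdᶠ fix-p pα)
    ... | inj₁ eq = eq
    -- The fixed vertex `w last` lies in `β` but not in `α`.
    ... | inj₂ eq with bwdᶠ {k = α} fix-last (subst (w last ∈ₑ_) (sym eq) (wβ refl))
    ...   | ()

    π-γ : π γ ≡ γ
    -- The edges through the fixed `q` are `α`, `β`, `γ`, and only `γ` misses the fixed `p`.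
    π-γ with π γ | fwdᶠ fix-q qγ | bwdᶠ {k = γ} fix-p
    ... | α | _ | p∈γ = contradiction (p∈γ pα) λ ()
    ... | β | _ | p∈γ = contradiction (p∈γ pβ) λ ()
    ... | γ | _ | _   = refl

    fix-w₀ : Fixed (w zero)
    fix-w₀ with ψ (w zero) in eq | subst (ψ (w zero) ∈ₑ_) π-α (fwd wα)
    ... | _ | pα = contradiction eq (unmoved fix-p λ ())
    ... | _ | qα = contradiction eq (unmoved fix-q λ ())
    ... | _ | wα = refl

    fix-s : Fixed s
    fix-s with ψ s in eq | subst (ψ s ∈ₑ_) π-γ (fwd sγ)
    ... | _ | qγ = contradiction eq (unmoved fix-q λ ())
    ... | _ | sγ = refl
    ... | _ | wγ refl = contradiction eq (unmoved fix-last λ ())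

    q∉link : ∀ {j} → ¬ q ∈ₑ π (link j)
    q∉link q∈ with bwdᶠ fix-q q∈
    ... | ()

    Settled : Fin (1 + m) → Set
    Settled j = Fixed (w (inject₁ j)) × π (link j) ≡ link j

    settled₀ : Settled zero
    settled₀ = fix-w₀ , π₀
      where
      π₀ : π (link zero) ≡ link zero
      -- Besides `link zero` only `α` contains `w zero`, and `α` contains the fixed `q`, which no
      -- link does.
      π₀ with π (link zero) in eq | fwdᶠ {k = link zero} fix-w₀ (wˡ refl)
      ... | α      | _ = contradiction (subst (q ∈ₑ_) (sym eq) qα) q∉link
      ... | β      | wβ ()
      ... | γ      | wγ ()
      ... | link j | wˡ e = cong link (sym (inject₁-injective {i = zero} e))

    -- The vertex `x` shared by `l` and `l′` stays in `l`. It cannot go to the `u` of `l`, which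
    -- lies in no other edge, since `π l′` is not `l`. Once `x` is fixed, `π l′` has to be the other
    -- edge through `x`.
    settled₊ : ∀ i → Settled (inject₁ i) → Settled (suc i)
    settled₊ i (fix-wᵢ , πᵢ) = fix-wᵢ₊₁ , πᵢ₊₁
      where
      l l′ : Edge
      l  = link (inject₁ i)
      l′ = link (suc i)
      x : Vertex
      x = w (suc (inject₁ i))

      πl′≢l : π l′ ≢ l
      πl′≢l eq = separates {k = l′} {l} uˡ (λ u∈l → u∉l u∈l refl) (trans eq (sym πᵢ))
        where
        u∉l : ∀ {y} → y ∈ₑ l → y ≢ u (suc i)
        u∉l uˡ eq = inject₁≢suc i (u-injective eq)
          where
          u-injective : ∀ {i j} → u i ≡ u j → i ≡ j
          u-injective refl = refl

      fix-wᵢ₊₁ : Fixed x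
      fix-wᵢ₊₁ with ψ x in eq | subst (ψ x ∈ₑ_) πᵢ (fwd (wʳ refl)) | fwd {x} {l′} (wˡ refl)
      ... | _ | wˡ refl | _ = contradiction eq (unmoved fix-wᵢ λ e → inject₁≢suc (inject₁ i) (sym (w-injective e)))
      ... | _ | wʳ refl | _ = refl
      ... | _ | uˡ | y∈πl′ = contradiction (u∈ y∈πl′) πl′≢l
        where
        u∈ : ∀ {j k} → u j ∈ₑ k → k ≡ link j
        u∈ uˡ = refl

      πᵢ₊₁ : π l′ ≡ l′
      πᵢ₊₁ with π l′ in eq | fwdᶠ {k = l′} fix-wᵢ₊₁ (wˡ refl)
      ... | β | wβ e = contradiction (sym (suc-injective e)) fromℕ≢inject₁
      ... | γ | wγ e = contradiction (sym (suc-injective e)) fromℕ≢inject₁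
      ... | link j | wˡ e = cong link (sym (inject₁-injective {i = suc i} e))
      ... | link j | wʳ refl = contradiction eq πl′≢l

    settled : ∀ j → Settled j
    settled = <-weakInduction Settled settled₀ settled₊

    fix-w : ∀ i → Fixed (w i)
    fix-w i with view i
    ... | ‵fromℕ     = fix-last
    ... | ‵inject₁ j = proj₁ (settled j)

    fix-u : ∀ j → Fixed (u j)
    fix-u j with ψ (u j) in eq | subst (ψ (u j) ∈ₑ_) (proj₂ (settled j)) (fwd uˡ)
    ... | _ | wˡ _ = contradiction eq (unmoved (fix-w _) λ ())
    ... | _ | wʳ _ = contradiction eq (unmoved (fix-w _) λ ())
    ... | _ | uˡ = refl

    rigid : ∀ x → Fixed x
    rigid p     = fix-p
    rigid q     = fix-q
    rigid s     = fix-s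
    rigid (w i) = fix-w i
    rigid (u j) = fix-u j

  asymmetric : Asymmetric E
  asymmetric φ (fwdφ , _) i = trans (cong f (sym (code-decode i)))
    (trans (sym (code-decode _)) (trans (cong code (Rigid.rigid A (decode i))) (code-decode i)))
    where
    f = Inverse.to φ
    π∃ : ∀ k → ∃ λ l → support l ≡ image f (support k)
    π∃ k = E⇒support _ (fwdφ (support k) (support∈E k))
    A : Automorphism
    A = record
      { ψ   = decode ∘ f ∘ code
      ; π   = proj₁ ∘ π∃
      ; inj = λ {x} {y} eq → code-injective (↔-injective φ _ _
                (trans (sym (code-decode _)) (trans (cong code eq) (code-decode _))))
      ; fwd = λ {x} {k} x∈k → code∈support⁻ _ (subst₂ _∈_ (sym (code-decode _)) (sym (proj₂ (π∃ k)))
                (∈-image⁺ f (support k) (∈-support⁺ x∈k)))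
      ; bwd = λ {x} {k} ψx∈ → code∈support⁻ k (∈-image-injective (↔-injective φ) (support k)
                (subst₂ _∈_ (code-decode _) (proj₂ (π∃ k)) (∈-support⁺ ψx∈)))
      }

  -- Proper induced subgraphs of the base graphs

  module Proper {X : Subset order} where

    _∈X : Vertex → Set
    x ∈X = code x ∈ X

    _∈X? : ∀ x → Dec (x ∈X)
    x ∈X? = code x ∈? X

    Present : Edge → Set
    Present k = ∀ {x} → x ∈ₑ k → x ∈X

    present : ∀ {k} → support k ⊆ X → Present k
    present k⊆X x∈k = k⊆X (∈-support⁺ x∈k)

    present? : ∀ k → Dec (Present k)
    present? k with all? (λ c → corner k c ∈X?)
    ... | yes all = yes λ x∈k → let c , eq = ∈-corner x∈k in subst _∈X eq (all c)
    ... | no ¬all = no λ pres → ¬all λ c → pres (corner-∈ k c)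

    vertexTwins : ∀ x y → x ∈X → y ∈X → x ≢ y →
                  (∀ k → Present k → (x ∈ₑ k → y ∈ₑ k) × (y ∈ₑ k → x ∈ₑ k)) → LocalSymmetry E X
    vertexTwins x y x∈X y∈X x≢y twin = twins x∈X y∈X (x≢y ∘ code-injective {x} {y}) λ S S⊆X S∈E → transfer S S⊆X (E⇒support S S∈E)
      where
      transfer : ∀ S → S ⊆ X → ∃ (λ k → support k ≡ S) → (code x ∈ S → code y ∈ S) × (code y ∈ S → code x ∈ S)
      transfer _ S⊆X (k , refl) =
        let x→y , y→x = twin k (present S⊆X)
        in ∈-support⁺ ∘ x→y ∘ code∈support⁻ k , ∈-support⁺ ∘ y→x ∘ code∈support⁻ k

    γ-absent : Present α → ¬ Present γ → LocalSymmetry E X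
    γ-absent Pα ¬Pγ = vertexTwins p q (Pα pα) (Pα qα) (λ ()) λ k Pk →
      p∈⇒q∈ , λ { qα → pα ; qβ → pβ ; qγ → ⊥-elim (¬Pγ Pk) }

    -- Apart from `α`, only `link zero` contains `w zero`, and it is also the only edge through
    -- `u zero`.
    α-absent : Present (link zero) → ¬ Present α → LocalSymmetry E X
    α-absent P₀ ¬Pα = vertexTwins (w zero) (u zero) (P₀ (wˡ refl)) (P₀ uˡ) (λ ()) λ k Pk →
      (λ { wα → ⊥-elim (¬Pα Pk) ; (wˡ {j = zero} refl) → uˡ ; (wˡ {j = suc _} ()) }) , λ { uˡ → wˡ refl }

    break-after : ∀ i → Present (link (inject₁ i)) → ¬ Present (link (suc i)) → LocalSymmetry E X
    break-after i Pᵢ ¬Pᵢ₊₁ = vertexTwins (w (suc (inject₁ i))) (u (inject₁ i)) (Pᵢ (wʳ refl)) (Pᵢ uˡ) (λ ()) λ k Pk → to k Pk , λ { uˡ → wʳ refl }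
      where
      to : ∀ k → Present k → w (suc (inject₁ i)) ∈ₑ k → u (inject₁ i) ∈ₑ k
      -- The break lies between two links, so this `w` is not `w last` and belongs to neither `β`
      -- nor `γ`.
      to β Pk (wβ e) = contradiction (sym (suc-injective e)) fromℕ≢inject₁
      to γ Pk (wγ e) = contradiction (sym (suc-injective e)) fromℕ≢inject₁
      to (link j) Pk (wˡ e) = ⊥-elim (¬Pᵢ₊₁ (subst (λ l → Present (link l)) (sym (inject₁-injective {i = suc i} e)) Pk))
      to (link j) Pk (wʳ refl) = uˡ

    break-before : ∀ i → ¬ Present (link (inject₁ i)) → Present (link (suc i)) → LocalSymmetry E X
    break-before i ¬Pᵢ Pᵢ₊₁ = vertexTwins (w (suc (inject₁ i))) (u (suc i)) (Pᵢ₊₁ (wˡ refl)) (Pᵢ₊₁ uˡ) (λ ()) λ k Pk → to k Pk , λ { uˡ → wˡ refl }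
      where
      to : ∀ k → Present k → w (suc (inject₁ i)) ∈ₑ k → u (suc i) ∈ₑ k
      to β Pk (wβ e) = contradiction (sym (suc-injective e)) fromℕ≢inject₁
      to γ Pk (wγ e) = contradiction (sym (suc-injective e)) fromℕ≢inject₁
      to (link j) Pk (wˡ e) = subst (λ l → u (suc i) ∈ₑ link l) (inject₁-injective {i = suc i} e) uˡ
      to (link j) Pk (wʳ refl) = ⊥-elim (¬Pᵢ Pk)

    -- The edges `α`, `γ` and the links cover all vertices, so a missed vertex shows that one of
    -- them is lost.
    all-present : Present α → Present γ → (∀ j → Present (link j)) → ∀ i → i ∈ X
    all-present Pα Pγ Pl i = subst (_∈ X) (code-decode i) (every (decode i))
      where
      every : ∀ x → x ∈X
      every p           = Pα pα
      every q           = Pα qα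
      every s           = Pγ sγ
      every (w zero)    = Pα wα
      every (w (suc j)) = Pl j (wʳ refl)
      every (u j)       = Pl j uˡ

    linked-case : ∀ {z} → z ∉ X → (∀ j → Present (link j)) → LocalSymmetry E X
    linked-case z∉X Pl with present? α | present? γ
    ... | no ¬Pα | _      = α-absent (Pl zero) ¬Pα
    ... | yes Pα | no ¬Pγ = γ-absent Pα ¬Pγ
    ... | yes Pα | yes Pγ = contradiction (all-present Pα Pγ Pl _) z∉X

    -- The edges `α`, `β`, `γ` are `q` joined to the consecutive pairs of `w zero`, `p`, `w last`,
    -- `s`; this map reverses that sequence. The test against `fromℕ m` recognises `w last`.
    ρ : Vertex → Vertex
    ρ p           = w last
    ρ q           = q
    ρ s           = w zero
    ρ (w zero)    = s
    ρ (w (suc i)) with i ≟ fromℕ m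
    ... | yes _ = p
    ... | no _  = w (suc i)
    ρ (u j)       = u j

    ρ-last : ρ (w last) ≡ p
    ρ-last with fromℕ m ≟ fromℕ m
    ... | yes _ = refl
    ... | no ¬e = contradiction refl ¬e

    ρ-involutive : ∀ x → ρ (ρ x) ≡ x
    ρ-involutive p        = ρ-last
    ρ-involutive q        = refl
    ρ-involutive s        = refl
    ρ-involutive (w zero) = refl
    ρ-involutive (w (suc i)) with i ≟ fromℕ m in eq
    ... | yes refl = refl
    ... | no _ rewrite eq = refl
    ρ-involutive (u j)    = refl

    mirror : Edge → Edge
    mirror α = γ
    mirror β = β
    mirror γ = α
    mirror (link j) = link j

    reflection : Present α → Present γ → (∀ j → ¬ Present (link j)) → LocalSymmetry E X
    reflection Pα Pγ ¬Pl = record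
      { σ          = σ
      ; involutive = σσ
      ; closed     = λ {i} i∈X → closed (decode i) (subst (_∈ X) (sym (code-decode i)) i∈X)
      ; preserves  = λ S S⊆X S∈E → preserves S S⊆X (E⇒support S S∈E)
      ; moved      = code p , Pα pα , λ eq → contradiction (code-injective {w last} {p} eq) λ ()
      }
      where
      σ : Fin order → Fin order
      σ = code ∘ ρ ∘ decode
      σσ : ∀ i → σ (σ i) ≡ i
      σσ i = trans (cong (code ∘ ρ) (decode-code (ρ (decode i)))) (trans (cong code (ρ-involutive (decode i))) (code-decode i))
      -- Presence of `α` and `γ` puts all four vertices moved by `ρ` into `X`.
      closed : ∀ x → x ∈X → ρ x ∈X
      closed p        _ = Pγ (wγ refl)
      closed q        h = h
      closed s        _ = Pα wα
      closed (w zero) _ = Pγ sγ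
      closed (w (suc i)) h with i ≟ fromℕ m
      ... | yes _ = Pα pα
      ... | no _  = h
      closed (u j)    h = h
      ρ∈ : ∀ {x} k → Present k → x ∈ₑ k → ρ x ∈ₑ mirror k
      ρ∈ α _ pα = wγ refl
      ρ∈ α _ qα = qγ
      ρ∈ α _ wα = sγ
      ρ∈ β _ pβ = wβ refl
      ρ∈ β _ qβ = qβ
      ρ∈ β _ (wβ refl) = subst (_∈ₑ β) (sym ρ-last) pβ
      ρ∈ γ _ qγ = qα
      ρ∈ γ _ sγ = wα
      ρ∈ γ _ (wγ refl) = subst (_∈ₑ α) (sym ρ-last) pα
      ρ∈ (link j) Pk _ = ⊥-elim (¬Pl j Pk)
      preserves : ∀ S → S ⊆ X → ∃ (λ k → support k ≡ S) → T (E (image σ S))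
      -- All supports have three elements, so one inclusion suffices.
      preserves _ k⊆X (k , refl) = subst (T ∘ E) (sym (⊆-∣∣-antisym sub size)) (support∈E (mirror k))
        where
        sub : image σ (support k) ⊆ support (mirror k)
        sub i∈ with ∈-image⁻ σ (support k) i∈
        ... | _ , j∈k , refl with ∈-support⁻ k j∈k
        ...   | x , x∈k , refl rewrite decode-code x = ∈-support⁺ (ρ∈ k (present k⊆X) x∈k)
        σ-injective : Injective σ
        σ-injective i j eq = trans (sym (σσ i)) (trans (cong σ eq) (σσ j))
        size : ∣ image σ (support k) ∣ ≡ ∣ support (mirror k) ∣
        size = trans (∣image∣ σ-injective (support k)) (trans (∣support∣ k) (sym (∣support∣ (mirror k))))

    -- Once `α` and all links are lost, only `β` and `γ` can remain, and both contain `q` and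
    -- `w last`. These two are twins if both lie in `X`; otherwise no edge is left.
    linkless-case : ∀ {x y} → x ∈ X → y ∈ X → x ≢ y → (∀ j → ¬ Present (link j)) → LocalSymmetry E X
    linkless-case x∈X y∈X x≢y ¬Pl with present? α | present? γ | q ∈X? | w last ∈X?
    ... | yes Pα | yes Pγ | _ | _ = reflection Pα Pγ ¬Pl
    ... | yes Pα | no ¬Pγ | _ | _ = γ-absent Pα ¬Pγ
    ... | no ¬Pα | _ | yes q∈X | yes w∈X = vertexTwins q (w last) q∈X w∈X (λ ()) λ k Pk →
        (λ { qα → ⊥-elim (¬Pα Pk) ; qβ → wβ refl ; qγ → wγ refl }) , back k Pk
      where
      back : ∀ k → Present k → w last ∈ₑ k → q ∈ₑ k
      back β _ _ = qβ
      back γ _ _ = qγ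
      back (link j) Pk _ = ⊥-elim (¬Pl j Pk)
    ... | no ¬Pα | _ | no q∉X | _ = edgeless x∈X y∈X x≢y λ S S⊆X S∈E → none S S⊆X (E⇒support S S∈E)
      where
      none : ∀ S → S ⊆ X → ¬ ∃ (λ k → support k ≡ S)
      none _ S⊆X (α , refl) = q∉X (present {α} S⊆X qα)
      none _ S⊆X (β , refl) = q∉X (present {β} S⊆X qβ)
      none _ S⊆X (γ , refl) = q∉X (present {γ} S⊆X qγ)
      none _ S⊆X (link j , refl) = ¬Pl j (present S⊆X)
    ... | no ¬Pα | _ | yes _ | no w∉X = edgeless x∈X y∈X x≢y λ S S⊆X S∈E → none S S⊆X (E⇒support S S∈E)
      where
      none : ∀ S → S ⊆ X → ¬ ∃ (λ k → support k ≡ S)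
      none _ S⊆X (α , refl) = ¬Pα (present S⊆X)
      none _ S⊆X (β , refl) = w∉X (present {β} S⊆X (wβ refl))
      none _ S⊆X (γ , refl) = w∉X (present {γ} S⊆X (wγ refl))
      none _ S⊆X (link j , refl) = ¬Pl j (present S⊆X)

  properlySymmetric : ProperlySymmetric E
  properlySymmetric X x∈X y∈X x≢y z∉X with any? (λ j → present? (link j))
    where open Proper {X}
  ... | no none  = Proper.linkless-case x∈X y∈X x≢y λ j Pj → none (j , Pj)
  ... | yes some with uniform-or-jump (λ j → Proper.present? (link j)) some
  ...   | inj₁ all                   = Proper.linked-case z∉X all
  ...   | inj₂ (i , inj₁ (Pi , ¬Pi)) = Proper.break-after i Pi ¬Pi
  ...   | inj₂ (i , inj₂ (¬Pi , Pi)) = Proper.break-before i ¬Pi Pi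

  -- Non-edges that avoid a given vertex

  nonedge : (f : Fin 3 → Vertex) → (∀ c d → f c ≡ f d → c ≡ d) → (∀ k → ¬ (∀ c → f c ∈ₑ k)) →
            ∣ image (code ∘ f) ⊤ ∣ ≡ 3 × ¬ T (E (image (code ∘ f) ⊤))
  nonedge f f-inj f∉ = trans (∣image∣ (λ c d → f-inj c d ∘ code-injective) ⊤) (∣⊤∣≡n 3) , λ f∈E →
    let k , eq = E⇒support _ f∈E
    in f∉ k λ c → code∈support⁻ k (subst (code (f c) ∈_) (sym eq) (∈-image⁺ (code ∘ f) ⊤ {c} ∈⊤))

  -- Two disjoint non-edges, so every vertex is missed by one of them. No edge contains both `p` and
  -- `s`, and the only edge through `q` and `w zero` is `α`, which misses `w last`.
  first second : Fin 3 → Vertex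
  first  = triple p s (u zero)
  second = triple q (w zero) (w last)

  avoiding : ∀ i → ∃ λ S → i ∉ S × ∣ S ∣ ≡ 3 × ¬ T (E S)
  avoiding i with i ∈? image (code ∘ first) ⊤
  ... | no i∉  = image (code ∘ first) ⊤ , i∉ , nonedge first (triple-injective (λ ()) (λ ()) (λ ())) first∉
    where
    first∉ : ∀ k → ¬ (∀ c → first c ∈ₑ k)
    first∉ k f∈ with f∈ 0F | f∈ 1F
    ... | pα | ()
    ... | pβ | ()
  ... | yes i∈ = image (code ∘ second) ⊤ , disjoint i∈ , nonedge second (triple-injective (λ ()) (λ ()) (λ ())) second∉
    where
    second∉ : ∀ k → ¬ (∀ c → second c ∈ₑ k)
    second∉ k f∈ with f∈ 0F | f∈ 1F | f∈ 2F
    ... | qα | wα    | ()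
    ... | qβ | wβ () | _
    ... | qγ | wγ () | _
    apart : ∀ c d → second d ≢ first c
    apart 0F 0F ()
    apart 0F 1F ()
    apart 0F 2F ()
    apart 1F 0F ()
    apart 1F 1F ()
    apart 1F 2F ()
    apart 2F 0F ()
    apart 2F 1F ()
    apart 2F 2F ()
    disjoint : i ∈ image (code ∘ first) ⊤ → i ∉ image (code ∘ second) ⊤
    disjoint i∈ i∈′ with ∈-image⁻ (code ∘ first) ⊤ i∈ | ∈-image⁻ (code ∘ second) ⊤ i∈′
    ... | c , _ , refl | d , _ , eq = apart c d (code-injective eq)

  extendable : Extendable 3 order
  extendable = record
    { E = E ; uniform = uniform ; asymmetric = asymmetric
    ; properlySymmetric = properlySymmetric ; avoiding = avoiding
    ; large = s≤s (s≤s (s≤s (s≤s (s≤s z≤n)))) }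

-- The infinite family for every k

coned : ∀ d m → Extendable (3 + d) (d + Base.order m)
coned zero    m = Base.extendable m
coned (suc d) m = extend (s≤s (s≤s z≤n)) (coned d m)

-- The order grows strictly with the number of links, and isomorphic graphs have equally many
-- vertices; this separates the members of the family.
order-injective : ∀ {i j} → Base.order i ≡ Base.order j → i ≡ j
order-injective {i} {j} eq with <-cmp i j
... | tri< i<j _ _ = contradiction eq (<⇒≢ (+-monoʳ-< 3 (+-mono-< (+-monoʳ-< 2 i<j) (+-monoʳ-< 1 i<j))))
... | tri≈ _ i≡j _ = i≡j
... | tri> _ _ j<i = contradiction (sym eq) (<⇒≢ (+-monoʳ-< 3 (+-mono-< (+-monoʳ-< 2 j<i) (+-monoʳ-< 1 j<i))))

theorem3 : (k : ℕ) → 3 ≤ k →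
    Σ (ℕ → Σ ℕ (KGraph k)) λ G →
    ((i : ℕ) → MinimalAsymmetric (Σ.proj₂ (G i))) ×
    ((i j : ℕ) → i ≢ j → ¬ Isomorphic (Σ.proj₂ (G i)) (Σ.proj₂ (G j)))
theorem3 (suc (suc (suc d))) (s≤s (s≤s (s≤s z≤n))) =
  (λ i → d + Base.order i , Extendable.graph (coned d i)) ,
  (λ i → Extendable.minimalAsymmetric (coned d i)) ,
  (λ i j i≢j iso → i≢j (order-injective (+-cancelˡ-≡ d _ _ (↔⇒≡ (proj₁ iso)))))
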